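{- Let $t$ be a term of the silly substitution calculus. If there is a derivation $\pi\triangleright\Gamma\vdash^{(m,e)} t : L$ in the silly multi type system, then $t$ is strongly $\to_w$-normalizing. Moreover, if $d: t\to_w^* n$ is a reduction sequence to a $\to_w$-normal term $n$, then the number of $\to_{wm}$ steps in $d$ is at most $m$ and the number of $\to_{we}$ steps in $d$ is at most $e$.
   Context: Terms: $t ::= x \mid \lambda x.t \mid t\,u \mid t[x\backslash u]$ ($t[x\backslash u]$ an explicit substitution binding $x$ in $t$; terms up to $\alpha$). Values $v ::= \lambda x.t$. Substitution contexts $S ::= \langle\cdot\rangle\mid S[x\backslash u]$. Weak contexts $W ::= \langle\cdot\rangle \mid W\,t \mid t\,W \mid t[x\backslash W] \mid W[x\backslash u]$; $W\langle\langle t\rangle\rangle$ is plugging without capture of free variables of $t$. Root rules: $S\langle\lambda x.t\rangle u\mapsto_m S\langle t[x\backslash u]\rangle$; $W\langle\langle x\rangle\rangle[x\backslash u]\mapsto_e W\langle\langle u\rangle\rangle[x\backslash u]$; $t[x\backslash S\langle v\rangle]\mapsto_{gcv} S\langle t\rangle$ if $x\notin\mathrm{fv}(t)$. $\to_{wm},\to_{we},\to_{wgcv}$ are their closures under weak contexts, $\to_w$ their union. Strongly normalizing: no infinite reduction sequence. Silly multi types: linear types $L ::= \mathtt{n} \mid M\multimap L$; multi types $M ::= [L_i]_{i\in I}$ finite multisets ($\mathbf{0}$ empty, $\uplus$ sum). Type contexts $\Gamma$ map variables to multi types with finite support; $\uplus$ pointwise; $\Gamma\setminus\!\!\setminus x$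 sets $x$ to $\mathbf{0}$. Rules: (ax) $x:[L]\vdash^{(0,1)} x:L$; (many) from $(\Gamma_i\vdash^{(m_i,e_i)} t : L_i)_{i\in I}$, $I$ finite possibly empty, infer $\uplus_i\Gamma_i\vdash^{(\sum m_i,\sum e_i)} t : [L_i]_{i\in I}$; ($\mathrm{ax}_\lambda$) $\vdash^{(0,0)}\lambda x.t:\mathtt{n}$; ($\lambda$) from $\Gamma\vdash^{(m,e)}t:L$ infer $\Gamma\setminus\!\!\setminus x\vdash^{(m,e)}\lambda x.t:\Gamma(x)\multimap L$; (@) from $\Gamma\vdash^{(m,e)} t : M\multimap L$ and $\Delta\vdash^{(m',e')} u : M\uplus[\mathtt{n}]$ infer $\Gamma\uplus\Delta\vdash^{(m+m'+1,e+e')} tu : L$; (ES) from $\Gamma\vdash^{(m,e)} t:L$ and $\Delta\vdash^{(m',e')}u:\Gamma(x)\uplus[\mathtt{n}]$ infer $(\Gamma\setminus\!\!\setminus x)\uplus\Delta\vdash^{(m+m',e+e')} t[x\backslash u]:L$. -}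

module Defs where

open import Data.Fin.Base using (Fin; zero; suc)
open import Data.List.Base using (List; []; [_]; _++_)
open import Data.List.Relation.Binary.Permutation.Homogeneous using (Permutation)
open import Data.Nat.Base using (ℕ; zero; suc; _+_)
open import Data.Product.Base using (_×_; _,_; ∃)
open import Data.Sum.Base using (_⊎_; inj₁; inj₂)
open import Data.Vec.Functional using (Vector; head; tail; foldr; toList; replicate; updateAt; zipWith)
open import Function.Base using (_∘_; id; const; flip)
open import Induction.InfiniteDescent using (InfiniteDescendingSequenceFrom)
open import Induction.WellFounded using (Acc; acc)
open import Level using (0ℓ)
open import Relation.Binary.Construct.Closure.ReflexiveTransitive using (Star; ε; _◅_)
open import Relation.Binary.Core using (Rel)
open import Relation.Binary.PropositionalEquality.Core using (refl)
open import Relation.Binary.Rewriting using (IsNormalForm)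
open import Relation.Nullary.Negation.Core using (¬_)

-- Terms up to α are well-scoped de Bruijn terms: Tm k has its free variables
-- in Fin k, and both ƛ t and t ⟦ u ⟧ (the explicit substitution t[x\u]) bind
-- index zero of t.

infix  4 _↦m_ _↦e_ _↦gcv_ _→wm_ _→we_ _→wgcv_ _→w_ _→w*_
infixl 7 _·_ _·ˡ_ _·ʳ_
infixl 8 _⟦_⟧ _⟦_⟧ˡ _⟦_⟧ʳ
infix  6 ƛ_

data Tm (k : ℕ) : Set where
  var  : Fin k → Tm k
  ƛ_   : Tm (suc k) → Tm k
  _·_  : Tm k → Tm k → Tm k
  _⟦_⟧ : Tm (suc k) → Tm k → Tm k

ext : ∀ {k l} → (Fin k → Fin l) → Fin (suc k) → Fin (suc l)
ext ρ zero    = zero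
ext ρ (suc x) = suc (ρ x)

rename : ∀ {k l} → (Fin k → Fin l) → Tm k → Tm l
rename ρ (var x)   = var (ρ x)
rename ρ (ƛ t)     = ƛ rename (ext ρ) t
rename ρ (t · u)   = rename ρ t · rename ρ u
rename ρ (t ⟦ u ⟧) = rename (ext ρ) t ⟦ rename ρ u ⟧

-- A context in SCtx k l or WCtx k l is itself in scope k and has its hole in
-- scope l.  Plugging _⟨_⟩ captures; the renaming skip embeds the outer scope
-- into the scope of the hole, so plugging a term renamed along it is
-- capture-free.

data SCtx : ℕ → ℕ → Set where
  ∙    : ∀ {k} → SCtx k k
  _⟦_⟧ : ∀ {k l} → SCtx (suc k) l → Tm k → SCtx k l

_ˢ⟨_⟩ : ∀ {k l} → SCtx k l → Tm l → Tm k
∙         ˢ⟨ t ⟩ = t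
(S ⟦ u ⟧) ˢ⟨ t ⟩ = (S ˢ⟨ t ⟩) ⟦ u ⟧

skipˢ : ∀ {k l} → SCtx k l → Fin k → Fin l
skipˢ ∙         = id
skipˢ (S ⟦ u ⟧) = skipˢ S ∘ suc

data WCtx : ℕ → ℕ → Set where
  ∙     : ∀ {k} → WCtx k k
  _·ˡ_  : ∀ {k l} → WCtx k l → Tm k → WCtx k l
  _·ʳ_  : ∀ {k l} → Tm k → WCtx k l → WCtx k l
  _⟦_⟧ʳ : ∀ {k l} → Tm (suc k) → WCtx k l → WCtx k l
  _⟦_⟧ˡ : ∀ {k l} → WCtx (suc k) l → Tm k → WCtx k l

_⟨_⟩ : ∀ {k l} → WCtx k l → Tm l → Tm k
∙          ⟨ s ⟩ = s
(W ·ˡ t)   ⟨ s ⟩ = W ⟨ s ⟩ · t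
(t ·ʳ W)   ⟨ s ⟩ = t · W ⟨ s ⟩
(t ⟦ W ⟧ʳ) ⟨ s ⟩ = t ⟦ W ⟨ s ⟩ ⟧
(W ⟦ u ⟧ˡ) ⟨ s ⟩ = (W ⟨ s ⟩) ⟦ u ⟧

skip : ∀ {k l} → WCtx k l → Fin k → Fin l
skip ∙          = id
skip (W ·ˡ t)   = skip W
skip (t ·ʳ W)   = skip W
skip (t ⟦ W ⟧ʳ) = skip W
skip (W ⟦ u ⟧ˡ) = skip W ∘ suc

_⟪_⟫ : ∀ {k l} → WCtx k l → Tm k → Tm k
W ⟪ t ⟫ = W ⟨ rename (skip W) t ⟩

data _↦m_ {k} : Rel (Tm k) 0ℓ where
  root-m : ∀ {l} (S : SCtx k l) (t : Tm (suc l)) (u : Tm k) →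
           (S ˢ⟨ ƛ t ⟩) · u ↦m S ˢ⟨ t ⟦ rename (skipˢ S) u ⟧ ⟩

data _↦e_ {k} : Rel (Tm k) 0ℓ where
  root-e : ∀ {l} (W : WCtx (suc k) l) (u : Tm k) →
           (W ⟪ var zero ⟫) ⟦ u ⟧ ↦e (W ⟪ rename suc u ⟫) ⟦ u ⟧

-- The body of the explicit substitution is rename suc t, i.e. a term in which
-- the bound variable (index zero) does not occur free.
data _↦gcv_ {k} : Rel (Tm k) 0ℓ where
  root-gcv : ∀ {l} (t : Tm k) (S : SCtx k l) (r : Tm (suc l)) →
             rename suc t ⟦ S ˢ⟨ ƛ r ⟩ ⟧ ↦gcv S ˢ⟨ rename (skipˢ S) t ⟩

data Weak (R : ∀ {l} → Rel (Tm l) 0ℓ) {k} : Rel (Tm k) 0ℓ where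
  weak : ∀ {l} (W : WCtx k l) {t u : Tm l} → R t u → Weak R (W ⟨ t ⟩) (W ⟨ u ⟩)

_→wm_ _→we_ _→wgcv_ _→w_ _→w*_ : ∀ {k} → Rel (Tm k) 0ℓ
_→wm_   = Weak _↦m_
_→we_   = Weak _↦e_
_→wgcv_ = Weak _↦gcv_
t →w u  = t →wm u ⊎ t →we u ⊎ t →wgcv u
_→w*_   = Star _→w_

#m #e : ∀ {k} {t u : Tm k} → t →w* u → ℕ
#m ε                   = 0
#m (inj₁ _ ◅ d)        = suc (#m d)
#m (inj₂ _ ◅ d)        = #m d
#e ε                   = 0
#e (inj₁ _ ◅ d)        = #e d
#e (inj₂ (inj₁ _) ◅ d) = suc (#e d)
#e (inj₂ (inj₂ _) ◅ d) = #e d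

Normal : ∀ {k} → Tm k → Set
Normal = IsNormalForm _→w_

-- Pointwise form of Relation.Binary.Rewriting.StronglyNormalizing; it rules
-- out infinite reduction sequences by SN⇒noInfiniteReduction.
SN : ∀ {k} → Tm k → Set
SN = Acc (flip _→w_)

SN⇒noInfiniteReduction : ∀ {k} {t : Tm k} → SN t →
  ¬ ∃ λ f → InfiniteDescendingSequenceFrom (flip _→w_) f t
SN⇒noInfiniteReduction (acc rs) (f , refl , step) =
  SN⇒noInfiniteReduction (rs (step 0)) (f ∘ suc , refl , step ∘ suc)

-- Finite multisets are lists, identified hereditarily up to permutation by
-- _≈_ on linear types and _≋_ on multi types; ⊎ on multi types is _++_.

infixr 6 _⊸_
infix  4 _≈_ _≋_ _≋ᶜ_
infixl 5 _⊎ᶜ_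

data Lin : Set

Multi : Set
Multi = List Lin

data Lin where
  𝕟   : Lin
  _⊸_ : Multi → Lin → Lin

data _≈_ : Rel Lin 0ℓ

_≋_ : Rel Multi 0ℓ
_≋_ = Permutation _≈_

data _≈_ where
  𝕟   : 𝕟 ≈ 𝕟
  _⊸_ : ∀ {M M′ L L′} → M ≋ M′ → L ≈ L′ → M ⊸ L ≈ M′ ⊸ L′

-- For the variable x bound at index zero, Γ(x) is head Γ and Γ∖∖x is tail Γ.
Ctx : ℕ → Set
Ctx = Vector Multi

_≋ᶜ_ : ∀ {k} → Rel (Ctx k) 0ℓ
Γ ≋ᶜ Δ = ∀ x → Γ x ≋ Δ x

∅ : ∀ {k} → Ctx k
∅ = replicate _ []

_∶[_] : ∀ {k} → Fin k → Lin → Ctx k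
x ∶[ L ] = updateAt ∅ x (const [ L ])

_⊎ᶜ_ : ∀ {k} → Ctx k → Ctx k → Ctx k
_⊎ᶜ_ = zipWith _++_

⨄ : ∀ {k i} → Vector (Ctx k) i → Ctx k
⨄ = foldr _⊎ᶜ_ ∅

∑ : ∀ {i} → Vector ℕ i → ℕ
∑ = foldr _+_ 0

-- The rules conv and conv⁺ only express that (contexts of) multisets are
-- represented by lists: they replace representatives and leave the indices
-- unchanged.

infix 3 _⊢⟨_,_⟩_∶_ _⊢⟨_,_⟩_∶⁺_

data _⊢⟨_,_⟩_∶_  {k} : Ctx k → ℕ → ℕ → Tm k → Lin → Set
data _⊢⟨_,_⟩_∶⁺_ {k} : Ctx k → ℕ → ℕ → Tm k → Multi → Set

data _⊢⟨_,_⟩_∶_ {k} where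
  ax   : ∀ {x L} →
         x ∶[ L ] ⊢⟨ 0 , 1 ⟩ var x ∶ L
  axλ  : ∀ {t} →
         ∅ ⊢⟨ 0 , 0 ⟩ ƛ t ∶ 𝕟
  lam  : ∀ {Γ m e t L} →
         Γ ⊢⟨ m , e ⟩ t ∶ L →
         tail Γ ⊢⟨ m , e ⟩ ƛ t ∶ head Γ ⊸ L
  app  : ∀ {Γ Δ m e m′ e′ t u M L} →
         Γ ⊢⟨ m , e ⟩ t ∶ M ⊸ L →
         Δ ⊢⟨ m′ , e′ ⟩ u ∶⁺ M ++ [ 𝕟 ] →
         Γ ⊎ᶜ Δ ⊢⟨ m + m′ + 1 , e + e′ ⟩ t · u ∶ L
  es   : ∀ {Γ Δ m e m′ e′ t u L} →
         Γ ⊢⟨ m , e ⟩ t ∶ L →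
         Δ ⊢⟨ m′ , e′ ⟩ u ∶⁺ head Γ ++ [ 𝕟 ] →
         tail Γ ⊎ᶜ Δ ⊢⟨ m + m′ , e + e′ ⟩ t ⟦ u ⟧ ∶ L
  conv : ∀ {Γ Γ′ m e t L L′} →
         Γ ≋ᶜ Γ′ → L ≈ L′ →
         Γ ⊢⟨ m , e ⟩ t ∶ L →
         Γ′ ⊢⟨ m , e ⟩ t ∶ L′

data _⊢⟨_,_⟩_∶⁺_ {k} where
  many  : ∀ {i t} {Γ : Vector (Ctx k) i} {m e : Vector ℕ i} {L : Vector Lin i} →
          (∀ j → Γ j ⊢⟨ m j , e j ⟩ t ∶ L j) →
          ⨄ Γ ⊢⟨ ∑ m , ∑ e ⟩ t ∶⁺ toList L
  conv⁺ : ∀ {Γ Γ′ m e t M M′} →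
          Γ ≋ᶜ Γ′ → M ≋ M′ →
          Γ ⊢⟨ m , e ⟩ t ∶⁺ M →
          Γ′ ⊢⟨ m , e ⟩ t ∶⁺ M′

{-# OPTIONS --safe #-}
module Submission where

-- Quantitative subject reduction.  Since every argument is typed with an extra
-- 𝕟, each weak redex is typed n ≥ 1 times in a derivation, and contracting it
-- acts on all n typings at once: →wm lowers m by n and keeps e, →we keeps m and
-- lowers e by n (n axioms are replaced by typings that were already counted at
-- the substituted term), and →wgcv keeps both.  This gives the bounds, and
-- strong normalization by the lexicographic measure (m + e , #es), as →wgcv
-- removes an explicit substitution.

open import Defs
open import Algebra.Bundles using (CommutativeMonoid)
import Algebra.Properties.CommutativeSemigroup as CommutativeSemigroupProperties
open import Data.Fin.Base using (Fin; zero; suc)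
open import Data.List.Base using ([]; _∷_; [_]; _++_; length)
open import Data.List.Properties using (length-++)
import Data.List.Relation.Binary.Permutation.Homogeneous as Perm
import Data.List.Relation.Binary.Permutation.Setoid.Properties as PermProperties
open import Data.List.Relation.Binary.Pointwise.Base using (Pointwise; []; _∷_)
open import Data.Nat.Base using (ℕ; zero; suc; _+_; _≤_; _<_; z≤n; s≤s)
open import Data.Nat.Properties
open import Data.Product.Base using (_×_; _,_; ∃; ∃₂)
open import Data.Sum.Base using (inj₁; inj₂)
open import Data.Vec.Functional as Vector using (Vector; tail; toList)
open import Function.Base using (_∘_; id)
open import Induction.WellFounded using (acc)
open import Level using (0ℓ)
open import Relation.Binary.Bundles using (Setoid)
open import Relation.Binary.Construct.Closure.ReflexiveTransitive using (ε; _◅_)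
open import Relation.Binary.Core using (Rel)
open import Relation.Binary.PropositionalEquality using (_≡_; refl; sym; trans; cong; cong₂)

private variable
  j k l : ℕ

-- Equivalence of types up to permutation.

≈-refl : ∀ {L} → L ≈ L
pointwise-refl : ∀ {M} → Pointwise _≈_ M M
≈-refl {𝕟}     = 𝕟
≈-refl {M ⊸ L} = Perm.refl pointwise-refl ⊸ ≈-refl
pointwise-refl {[]}    = []
pointwise-refl {L ∷ M} = ≈-refl ∷ pointwise-refl

≈-sym : ∀ {L L′} → L ≈ L′ → L′ ≈ L
≋-sym : ∀ {M M′} → M ≋ M′ → M′ ≋ M
pointwise-sym : ∀ {M M′} → Pointwise _≈_ M M′ → Pointwise _≈_ M′ M
≈-sym 𝕟       = 𝕟
≈-sym (p ⊸ q) = ≋-sym p ⊸ ≈-sym q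
≋-sym (Perm.refl ps)    = Perm.refl (pointwise-sym ps)
≋-sym (Perm.prep p q)   = Perm.prep (≈-sym p) (≋-sym q)
≋-sym (Perm.swap p q r) = Perm.swap (≈-sym q) (≈-sym p) (≋-sym r)
≋-sym (Perm.trans p q)  = Perm.trans (≋-sym q) (≋-sym p)
pointwise-sym []       = []
pointwise-sym (p ∷ ps) = ≈-sym p ∷ pointwise-sym ps

≈-trans : ∀ {L L′ L″} → L ≈ L′ → L′ ≈ L″ → L ≈ L″
≈-trans 𝕟       𝕟         = 𝕟
≈-trans (p ⊸ q) (p′ ⊸ q′) = Perm.trans p p′ ⊸ ≈-trans q q′

≈-setoid : Setoid 0ℓ 0ℓ
≈-setoid = record
  { _≈_ = _≈_
  ; isEquivalence = record { refl = ≈-refl ; sym = ≈-sym ; trans = ≈-trans }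
  }

module ≋ = CommutativeMonoid (PermProperties.++-commutativeMonoid ≈-setoid)

-- The commutative monoid of resources.

-- The resources of a judgement: its type context together with both indices.
-- Bundling them turns all bookkeeping into commutative monoid reasoning.
record Res (k : ℕ) : Set where
  constructor res
  field
    ctx : Ctx k
    mul : ℕ
    exp : ℕ

open Res

infix 4 _≃_

record _≃_ (A B : Res k) : Set where
  constructor mk≃
  field
    ctx-≋ : ctx A ≋ᶜ ctx B
    mul-≡ : mul A ≡ mul B
    exp-≡ : exp A ≡ exp B

open _≃_

infixl 6 _⊕_
infixr 5 _▹_

_⊕_ : Res k → Res k → Res k
A ⊕ B = res (ctx A ⊎ᶜ ctx B) (mul A + mul B) (exp A + exp B)

ticks : ℕ → ℕ → Res k
ticks = res ∅

𝟘 : Res k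
𝟘 = ticks 0 0

use : Fin k → Lin → Res k
use x L = res (x ∶[ L ]) 0 1

_▹_ : Multi → Res k → Res (suc k)
M ▹ A = res (M Vector.∷ ctx A) (mul A) (exp A)

hd : Res (suc k) → Multi
hd A = ctx A zero

tl : Res (suc k) → Res k
tl A = res (tail (ctx A)) (mul A) (exp A)

⊕-commutativeMonoid : ℕ → CommutativeMonoid 0ℓ 0ℓ
⊕-commutativeMonoid k = record
  { Carrier = Res k
  ; _≈_ = _≃_
  ; _∙_ = _⊕_
  ; ε = 𝟘
  ; isCommutativeMonoid = record
    { isMonoid = record
      { isSemigroup = record
        { isMagma = record
          { isEquivalence = record
            { refl  = mk≃ (λ _ → ≋.refl) refl refl
            ; sym   = λ p → mk≃ (λ x → ≋.sym (ctx-≋ p x)) (sym (mul-≡ p)) (sym (exp-≡ p))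
            ; trans = λ p q → mk≃ (λ x → ≋.trans (ctx-≋ p x) (ctx-≋ q x))
                                  (trans (mul-≡ p) (mul-≡ q)) (trans (exp-≡ p) (exp-≡ q))
            }
          ; ∙-cong = λ p q → mk≃ (λ x → ≋.∙-cong (ctx-≋ p x) (ctx-≋ q x))
                                 (cong₂ _+_ (mul-≡ p) (mul-≡ q)) (cong₂ _+_ (exp-≡ p) (exp-≡ q))
          }
        ; assoc = λ A B C → mk≃ (λ x → ≋.assoc (ctx A x) (ctx B x) (ctx C x))
                                (+-assoc (mul A) (mul B) (mul C)) (+-assoc (exp A) (exp B) (exp C))
        }
      ; identity = (λ A → mk≃ (λ _ → ≋.refl) refl refl)
                 , (λ A → mk≃ (λ x → ≋.identityʳ (ctx A x)) (+-identityʳ (mul A)) (+-identityʳ (exp A)))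
      }
    ; comm = λ A B → mk≃ (λ x → ≋.comm (ctx A x) (ctx B x)) (+-comm (mul A) (mul B)) (+-comm (exp A) (exp B))
    }
  }

module _ {k : ℕ} where
  open CommutativeMonoid (⊕-commutativeMonoid k) public
    using ()
    renaming ( refl to ≃-refl; sym to ≃-sym; trans to ≃-trans
             ; assoc to ⊕-assoc; comm to ⊕-comm; ∙-cong to ⊕-cong; ∙-congˡ to ⊕-congˡ; ∙-congʳ to ⊕-congʳ
             ; identityˡ to ⊕-identityˡ; identityʳ to ⊕-identityʳ )
  open CommutativeSemigroupProperties (CommutativeMonoid.commutativeSemigroup (⊕-commutativeMonoid k)) public
    using (interchange; x∙yz≈y∙xz; xy∙z≈xz∙y)
  module ≃-Reasoning where
    open import Relation.Binary.Reasoning.Setoid (CommutativeMonoid.setoid (⊕-commutativeMonoid k)) public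

▹-≃ : {A B : Res (suc k)} → hd A ≋ hd B → tl A ≃ tl B → A ≃ B
▹-≃ p q = mk≃ (λ { zero → p ; (suc x) → ctx-≋ q x }) (mul-≡ q) (exp-≡ q)

hd-cong : {A B : Res (suc k)} → A ≃ B → hd A ≋ hd B
hd-cong p = ctx-≋ p zero

tl-cong : {A B : Res (suc k)} → A ≃ B → tl A ≃ tl B
tl-cong p = mk≃ (ctx-≋ p ∘ suc) (mul-≡ p) (exp-≡ p)

-- Syntax-directed typing.

-- A syntax-directed presentation of the type system: conv and conv⁺ are
-- absorbed into the side conditions, so inversion is pattern matching.

infix 3 _⊩_∶_ _⊩_∶⁺_

data _⊩_∶_  {k} (Θ : Res k) : Tm k → Lin → Set
data _⊩_∶⁺_ {k} (Θ : Res k) (t : Tm k) : Multi → Set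

data _⊩_∶_ {k} Θ where
  ax  : ∀ {x L} → Θ ≃ use x L → Θ ⊩ var x ∶ L
  axλ : ∀ {t} → Θ ≃ 𝟘 → Θ ⊩ ƛ t ∶ 𝕟
  lam : ∀ {t M L} → M ▹ Θ ⊩ t ∶ L → Θ ⊩ ƛ t ∶ M ⊸ L
  app : ∀ {A B t u M L} → A ⊩ t ∶ M ⊸ L → B ⊩ u ∶⁺ 𝕟 ∷ M →
        Θ ≃ A ⊕ (B ⊕ ticks 1 0) → Θ ⊩ t · u ∶ L
  es  : ∀ {A B t u M L} → M ▹ A ⊩ t ∶ L → B ⊩ u ∶⁺ 𝕟 ∷ M →
        Θ ≃ A ⊕ B → Θ ⊩ t ⟦ u ⟧ ∶ L

data _⊩_∶⁺_ {k} Θ t where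
  nil  : Θ ≃ 𝟘 → Θ ⊩ t ∶⁺ []
  cons : ∀ {A B L M} → A ⊩ t ∶ L → B ⊩ t ∶⁺ M → Θ ≃ A ⊕ B → Θ ⊩ t ∶⁺ L ∷ M

⊩-conv : ∀ {Θ Θ′ : Res k} {t L L′} → Θ ≃ Θ′ → L ≈ L′ → Θ ⊩ t ∶ L → Θ′ ⊩ t ∶ L′
⊩-conv p q (ax {x} r) = ax (≃-trans (≃-sym p) (≃-trans r (use-cong x q)))
  where
  use-cong : ∀ {k} (x : Fin k) {L L′} → L ≈ L′ → use x L ≃ use x L′
  use-cong zero    q = ▹-≃ (Perm.prep q ≋.refl) ≃-refl
  use-cong (suc x) q = ▹-≃ ≋.refl (use-cong x q)
⊩-conv p 𝕟       (axλ r)     = axλ (≃-trans (≃-sym p) r)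
⊩-conv p (r ⊸ q) (lam d)     = lam (⊩-conv (▹-≃ r p) q d)
⊩-conv p q       (app d f r) = app (⊩-conv ≃-refl (≋.refl ⊸ q) d) f (≃-trans (≃-sym p) r)
⊩-conv p q       (es d f r)  = es (⊩-conv ≃-refl q d) f (≃-trans (≃-sym p) r)

⊩-resp : ∀ {Θ Θ′ : Res k} {t L} → Θ ≃ Θ′ → Θ ⊩ t ∶ L → Θ′ ⊩ t ∶ L
⊩-resp p = ⊩-conv p ≈-refl

⊩⁺-resp : ∀ {Θ Θ′ : Res k} {t M} → Θ ≃ Θ′ → Θ ⊩ t ∶⁺ M → Θ′ ⊩ t ∶⁺ M
⊩⁺-resp p (nil q)      = nil (≃-trans (≃-sym p) q)
⊩⁺-resp p (cons d f q) = cons d f (≃-trans (≃-sym p) q)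

⊩⁺-conv : ∀ {Θ : Res k} {t M M′} → M ≋ M′ → Θ ⊩ t ∶⁺ M → Θ ⊩ t ∶⁺ M′
⊩⁺-conv (Perm.refl [])       (nil r)      = nil r
⊩⁺-conv (Perm.refl (p ∷ ps)) (cons d f r) = cons (⊩-conv ≃-refl p d) (⊩⁺-conv (Perm.refl ps) f) r
⊩⁺-conv (Perm.prep p q)      (cons d f r) = cons (⊩-conv ≃-refl p d) (⊩⁺-conv q f) r
⊩⁺-conv (Perm.swap p q s)    (cons {A} d (cons {B} {C} d′ f r′) r) =
  cons (⊩-conv ≃-refl q d′) (cons (⊩-conv ≃-refl p d) (⊩⁺-conv s f) ≃-refl)
       (≃-trans r (≃-trans (⊕-congˡ r′) (x∙yz≈y∙xz A B C)))
⊩⁺-conv (Perm.trans p q)     f            = ⊩⁺-conv q (⊩⁺-conv p f)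

⊢⇒⊩ : ∀ {Γ : Ctx k} {m e t L} → Γ ⊢⟨ m , e ⟩ t ∶ L → res Γ m e ⊩ t ∶ L
⊢⁺⇒⊩⁺ : ∀ {Γ : Ctx k} {m e t M} → Γ ⊢⟨ m , e ⟩ t ∶⁺ M → res Γ m e ⊩ t ∶⁺ M
⊢⇒⊩ ax = ax ≃-refl
⊢⇒⊩ axλ = axλ ≃-refl
⊢⇒⊩ (lam d) = lam (⊩-resp (▹-≃ ≋.refl ≃-refl) (⊢⇒⊩ d))
⊢⇒⊩ (app {Γ} {Δ} {m} {e} {m′} {e′} {M = M} d f) =
  -- The extra `𝕟` moves to the front, where the list of typings is visibly nonempty.
  app (⊢⇒⊩ d) (⊩⁺-conv (≋.comm M [ 𝕟 ]) (⊢⁺⇒⊩⁺ f))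
      (≃-trans (mk≃ (λ _ → ≋.sym (≋.identityʳ _)) refl (sym (+-identityʳ _)))
               (⊕-assoc (res Γ m e) (res Δ m′ e′) (ticks 1 0)))
⊢⇒⊩ (es {Γ} d f) =
  es (⊩-resp (▹-≃ ≋.refl ≃-refl) (⊢⇒⊩ d)) (⊩⁺-conv (≋.comm (Γ zero) [ 𝕟 ]) (⊢⁺⇒⊩⁺ f)) ≃-refl
⊢⇒⊩ (conv p q d) = ⊩-conv (mk≃ p refl refl) q (⊢⇒⊩ d)
⊢⁺⇒⊩⁺ (many ds) = collect (λ i → ⊢⇒⊩ (ds i))
  where
  collect : ∀ {n t} {Γ : Vector (Ctx _) n} {m e : Vector ℕ n} {L : Vector Lin n} →
            (∀ i → res (Γ i) (m i) (e i) ⊩ t ∶ L i) → res (⨄ Γ) (∑ m) (∑ e) ⊩ t ∶⁺ toList L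
  collect {zero}  ds = nil ≃-refl
  collect {suc n} ds = cons (ds zero) (collect (ds ∘ suc)) ≃-refl
⊢⁺⇒⊩⁺ (conv⁺ p q f) = ⊩⁺-resp (mk≃ p refl refl) (⊩⁺-conv q (⊢⁺⇒⊩⁺ f))

single : ∀ {Θ : Res k} {t L} → Θ ⊩ t ∶⁺ [ L ] → Θ ⊩ t ∶ L
single (cons d (nil p) q) = ⊩-resp (≃-sym (≃-trans q (≃-trans (⊕-congˡ p) (⊕-identityʳ _)))) d

⊩⁺-[] : ∀ {Θ : Res k} {t} → Θ ⊩ t ∶⁺ [] → Θ ≃ 𝟘
⊩⁺-[] (nil p) = p

⊩⁺-split : ∀ M {N} {Θ : Res k} {t} → Θ ⊩ t ∶⁺ M ++ N →
           ∃₂ λ A B → A ⊩ t ∶⁺ M × B ⊩ t ∶⁺ N × Θ ≃ A ⊕ B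
⊩⁺-split []      f            = 𝟘 , _ , nil ≃-refl , f , ≃-sym (⊕-identityˡ _)
⊩⁺-split (L ∷ M) (cons {C} d f p) =
  let A , B , g , h , q = ⊩⁺-split M f
  in  _ , B , cons d g ≃-refl , h , ≃-trans p (≃-trans (⊕-congˡ q) (≃-sym (⊕-assoc C A B)))

-- Typing under renaming.

-- The forward action of a renaming on resources is carried as data: computing it from an arbitrary
-- `ρ` would mean summing over preimages, while the embeddings used here build it structurally.
record Weakening (ρ : Fin k → Fin l) : Set where
  field
    push       : Res k → Res l
    push-cong  : ∀ {A B} → A ≃ B → push A ≃ push B
    push-⊕     : ∀ A B → push (A ⊕ B) ≃ push A ⊕ push B
    push-ticks : ∀ m e → push (ticks m e) ≃ ticks m e
    push-use   : ∀ x L → push (use x L) ≃ use (ρ x) L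

  push-⊕-≃ : ∀ {A A₁ A₂} → A ≃ A₁ ⊕ A₂ → push A ≃ push A₁ ⊕ push A₂
  push-⊕-≃ p = ≃-trans (push-cong p) (push-⊕ _ _)

open Weakening

idʷ : Weakening {k} id
idʷ = record
  { push = id ; push-cong = id ; push-⊕ = λ _ _ → ≃-refl
  ; push-ticks = λ _ _ → ≃-refl ; push-use = λ _ _ → ≃-refl }

sucʷ : {ρ : Fin k → Fin l} → Weakening ρ → Weakening (suc ∘ ρ)
sucʷ ω = record
  { push       = λ A → [] ▹ push ω A
  ; push-cong  = λ p → ▹-≃ ≋.refl (push-cong ω p)
  ; push-⊕     = λ A B → ▹-≃ ≋.refl (push-⊕ ω A B)
  ; push-ticks = λ m e → ▹-≃ ≋.refl (push-ticks ω m e)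
  ; push-use   = λ x L → ▹-≃ ≋.refl (push-use ω x L)
  }

extʷ : {ρ : Fin k → Fin l} → Weakening ρ → Weakening (ext ρ)
extʷ ω = record
  { push       = λ A → hd A ▹ push ω (tl A)
  ; push-cong  = λ p → ▹-≃ (hd-cong p) (push-cong ω (tl-cong p))
  ; push-⊕     = λ A B → ▹-≃ ≋.refl (push-⊕ ω (tl A) (tl B))
  ; push-ticks = λ m e → ▹-≃ ≋.refl (push-ticks ω m e)
  ; push-use   = λ { zero    L → ▹-≃ ≋.refl (push-ticks ω 0 1)
                   ; (suc x) L → ▹-≃ ≋.refl (push-use ω x L) }
  }

-- The accumulated `ρ` lets `sucʷ` absorb each binder that is crossed, so that the composed
-- renamings match definitionally.
skipʷ : {ρ : Fin j → Fin k} (W : WCtx k l) → Weakening ρ → Weakening (skip W ∘ ρ)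
skipʷ ∙          ω = ω
skipʷ (W ·ˡ t)   ω = skipʷ W ω
skipʷ (t ·ʳ W)   ω = skipʷ W ω
skipʷ (t ⟦ W ⟧ʳ) ω = skipʷ W ω
skipʷ (W ⟦ u ⟧ˡ) ω = skipʷ W (sucʷ ω)

skipˢʷ : {ρ : Fin j → Fin k} (S : SCtx k l) → Weakening ρ → Weakening (skipˢ S ∘ ρ)
skipˢʷ ∙         ω = ω
skipˢʷ (S ⟦ u ⟧) ω = skipˢʷ S (sucʷ ω)

⊩-rename  : ∀ {ρ : Fin k → Fin l} (ω : Weakening ρ) {Θ t L} →
            Θ ⊩ t ∶ L → push ω Θ ⊩ rename ρ t ∶ L
⊩⁺-rename : ∀ {ρ : Fin k → Fin l} (ω : Weakening ρ) {Θ t M} →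
            Θ ⊩ t ∶⁺ M → push ω Θ ⊩ rename ρ t ∶⁺ M
⊩-rename ω (ax p)      = ax (≃-trans (push-cong ω p) (push-use ω _ _))
⊩-rename ω (axλ p)     = axλ (≃-trans (push-cong ω p) (push-ticks ω 0 0))
⊩-rename ω (lam d)     = lam (⊩-rename (extʷ ω) d)
⊩-rename ω (app d f p) = app (⊩-rename ω d) (⊩⁺-rename ω f)
  (≃-trans (push-⊕-≃ ω p) (⊕-congˡ (≃-trans (push-⊕ ω _ _) (⊕-congˡ (push-ticks ω 1 0)))))
⊩-rename ω (es d f p)  = es (⊩-rename (extʷ ω) d) (⊩⁺-rename ω f) (push-⊕-≃ ω p)
⊩⁺-rename ω (nil p)      = nil (≃-trans (push-cong ω p) (push-ticks ω 0 0))
⊩⁺-rename ω (cons d f p) = cons (⊩-rename ω d) (⊩⁺-rename ω f) (push-⊕-≃ ω p)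

-- The free variables of `rename ρ t` lie in the image of `ρ`, so no typing uses resources
-- elsewhere. For `suc` this gives index zero the empty multi type.
⊩-unrename  : ∀ {ρ : Fin k → Fin l} (ω : Weakening ρ) t {Θ L} →
              Θ ⊩ rename ρ t ∶ L → ∃ λ A → A ⊩ t ∶ L × Θ ≃ push ω A
⊩⁺-unrename : ∀ {ρ : Fin k → Fin l} (ω : Weakening ρ) t {Θ M} →
              Θ ⊩ rename ρ t ∶⁺ M → ∃ λ A → A ⊩ t ∶⁺ M × Θ ≃ push ω A
⊩-unrename ω (var x) (ax p) = _ , ax ≃-refl , ≃-trans p (≃-sym (push-use ω x _))
⊩-unrename ω (ƛ t) (axλ p) = _ , axλ ≃-refl , ≃-trans p (≃-sym (push-ticks ω 0 0))
⊩-unrename ω (ƛ t) (lam d) =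
  let A , d′ , p = ⊩-unrename (extʷ ω) t d
  in  tl A , lam (⊩-resp (▹-≃ (≋.sym (hd-cong p)) ≃-refl) d′) , tl-cong p
⊩-unrename ω (t · u) (app d f p) =
  let A , d′ , q = ⊩-unrename ω t d
      B , f′ , r = ⊩⁺-unrename ω u f
  in  _ , app d′ f′ ≃-refl ,
      ≃-trans p (≃-sym (≃-trans (push-⊕ ω _ _) (⊕-cong (≃-sym q)
        (≃-trans (push-⊕ ω _ _) (⊕-cong (≃-sym r) (push-ticks ω 1 0))))))
⊩-unrename ω (t ⟦ u ⟧) (es d f p) =
  let A , d′ , q = ⊩-unrename (extʷ ω) t d
      B , f′ , r = ⊩⁺-unrename ω u f
  in  _ , es (⊩-resp (▹-≃ (≋.sym (hd-cong q)) ≃-refl) d′) f′ ≃-refl ,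
      ≃-trans p (≃-trans (⊕-cong (tl-cong q) r) (≃-sym (push-⊕ ω _ _)))
⊩⁺-unrename ω t (nil p) = _ , nil ≃-refl , ≃-trans p (≃-sym (push-ticks ω 0 0))
⊩⁺-unrename ω t (cons d f p) =
  let A , d′ , q = ⊩-unrename ω t d
      B , f′ , r = ⊩⁺-unrename ω t f
  in  _ , cons d′ f′ ≃-refl , ≃-trans p (≃-trans (⊕-cong q r) (≃-sym (push-⊕ ω _ _)))

-- Filling substitution contexts.

-- The hole lies in the body of every substitution of `S`, so it is typed exactly once and the moved
-- resources `A` enter without multiplicity.
⊩-fill-S : ∀ {ρ : Fin j → Fin k} (S : SCtx k l) (ω : Weakening ρ) {A Θ s s′ K L} →
           Θ ⊩ S ˢ⟨ s ⟩ ∶ K →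
           (∀ {C} → C ⊩ s ∶ K → C ⊕ push (skipˢʷ S ω) A ⊩ s′ ∶ L) →
           Θ ⊕ push ω A ⊩ S ˢ⟨ s′ ⟩ ∶ L
⊩-fill-S ∙         ω d          h = h d
⊩-fill-S (S ⟦ u ⟧) ω {A} (es {B} {C} d f p) h =
  -- Pushing along `sucʷ` adds nothing at the bound variable, so `f` still fits.
  es (⊩-resp (▹-≃ (≋.identityʳ _) ≃-refl) (⊩-fill-S S (sucʷ ω) d h)) f
     (≃-trans (⊕-congʳ p) (xy∙z≈xz∙y B C (push ω A)))

-- Replacement in weak contexts.

-- Replacing the hole of a weak context exchanges, in each of its typings, the
-- resources G M for some resources F with J F M.  Both M and F are sums over
-- the typings of the hole, of which there is at least one because every
-- argument carries an extra 𝕟.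
module Replacement {j}
  (G : Multi → Res j) (J : Res j → Multi → Set)
  (G-[] : G [] ≃ 𝟘) (G-++ : ∀ M N → G (M ++ N) ≃ G M ⊕ G N)
  (J-[] : ∀ {F} → J F [] → F ≃ 𝟘)
  (J-++ : ∀ M {N F} → J F (M ++ N) → ∃₂ λ F₁ F₂ → J F₁ M × J F₂ N × F ≃ F₁ ⊕ F₂)
  where

  -- `complete` takes the supply `F` after `index` is known: an exponential step can split the
  -- typing of its argument only once the types used at the hole are found.
  record Exchange {k} {ρ : Fin j → Fin k} (ω : Weakening ρ) (n : ℕ) (Θ : Res k) (T : Res k → Set) : Set where
    constructor exchange
    field
      {index}  : Multi
      index-≥  : n ≤ length index
      {rest}   : Res k
      split    : Θ ≃ rest ⊕ push ω (G index)
      complete : ∀ {F} → J F index → T (rest ⊕ push ω F)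

  Replaces : {ρ : Fin j → Fin k} → Weakening ρ → Rel (Tm k) 0ℓ
  Replaces ω s s′ = ∀ {Θ L} → Θ ⊩ s ∶ L → Exchange ω 1 Θ (_⊩ s′ ∶ L)

  Exchange-map : ∀ {ρ : Fin j → Fin k} {ω : Weakening ρ} {m n Θ Θ′ B} {T T′ : Res k → Set} →
                 m ≤ n → Θ′ ≃ Θ ⊕ B → (∀ {A A′} → T A → A′ ≃ A ⊕ B → T′ A′) →
                 Exchange ω n Θ T → Exchange ω m Θ′ T′
  Exchange-map {ω = ω} {B = B} m≤n p f (exchange {M} n≤ {A} q c) =
    exchange (≤-trans m≤n n≤) (≃-trans p (≃-trans (⊕-congʳ q) (xy∙z≈xz∙y A (push ω (G M)) B)))
             (λ {F} J → f (c J) (xy∙z≈xz∙y A B (push ω F)))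

  Replaces-⁺ : ∀ {ρ : Fin j → Fin k} {ω : Weakening ρ} {s s′} → Replaces ω s s′ →
               ∀ {Θ M} → Θ ⊩ s ∶⁺ M → Exchange ω (length M) Θ (_⊩ s′ ∶⁺ M)
  Replaces-⁺ {ω = ω} r {Θ} (nil p) =
    exchange z≤n (≃-sym (≃-trans (⊕-congˡ (push-𝟘 G-[])) (⊕-identityʳ Θ)))
                 (λ J → nil (≃-trans (⊕-cong p (push-𝟘 (J-[] J))) (⊕-identityʳ 𝟘)))
    where
    push-𝟘 : ∀ {A} → A ≃ 𝟘 → push ω A ≃ 𝟘
    push-𝟘 q = ≃-trans (push-cong ω q) (push-ticks ω 0 0)
  Replaces-⁺ {ω = ω} r (cons d f p) with r d | Replaces-⁺ r f
  ... | exchange {M} 1≤ {A} q c | exchange {N} n≤ {B} q′ c′ =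
    exchange
      (≤-trans (+-mono-≤ 1≤ n≤) (≤-reflexive (sym (length-++ M))))
      (≃-trans p (≃-trans (⊕-cong q q′) (≃-trans (interchange A (push ω (G M)) B (push ω (G N)))
        (⊕-congˡ {x = A ⊕ B} (≃-sym (push-⊕-≃ ω {A₁ = G M} {G N} (G-++ M N)))))))
      (λ J → let F₁ , F₂ , J₁ , J₂ , e = J-++ M J in
        cons (c J₁) (c′ J₂) 
          (≃-trans (⊕-congˡ {x = A ⊕ B} (push-⊕-≃ ω {A₁ = F₁} {F₂} e))
                   (interchange A B (push ω F₁) (push ω F₂))))

  Replaces-W : ∀ {ρ : Fin j → Fin k} (W : WCtx k l) (ω : Weakening ρ) {s s′} →
               Replaces (skipʷ W ω) s s′ → Replaces ω (W ⟨ s ⟩) (W ⟨ s′ ⟩)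
  Replaces-W ∙ ω r d = r d
  Replaces-W (W ·ˡ t) ω r (app d f p) =
    Exchange-map ≤-refl p (λ d′ → app d′ f) (Replaces-W W ω r d)
  Replaces-W (t ·ʳ W) ω r (app {A} {B} d f p) =
    -- The argument is typed with `𝕟 ∷ M`, so the hole is typed even when `M` is empty.
    Exchange-map (s≤s z≤n) (≃-trans p (x∙yz≈y∙xz A B (ticks 1 0)))
      (λ {C} f′ q → app d f′ (≃-trans q (x∙yz≈y∙xz C A (ticks 1 0)))) (Replaces-⁺ (Replaces-W W ω r) f)
  Replaces-W (t ⟦ W ⟧ʳ) ω r (es {A} {B} d f p) =
    Exchange-map (s≤s z≤n) (≃-trans p (⊕-comm A B))
      (λ {C} f′ q → es d f′ (≃-trans q (⊕-comm C A))) (Replaces-⁺ (Replaces-W W ω r) f)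
  Replaces-W (W ⟦ u ⟧ˡ) ω r (es d f p) with Replaces-W W (sucʷ ω) r d
  -- What is pushed along `sucʷ` is empty at index zero, so the exchange leaves the multi type
  -- required of `u` unchanged.
  ... | exchange 1≤ q c =
    Exchange-map ≤-refl p (λ d′ → es d′ f)
      (exchange 1≤ (tl-cong q)
        (λ J → ⊩-resp (▹-≃ (≋.sym (hd-cong q)) ≃-refl) (c J)))

-- Quantitative subject reduction.

-- Drops at separate typings of a redex have to add up to the drop for their total number.
record Additive (f : ℕ → ℕ) : Set where
  field
    zero-homo : f 0 ≡ 0
    +-homo    : ∀ m n → f (m + n) ≡ f m + f n

-- length M is the number of typings of the contracted redex; M has no other role.
Lowers : (f g : ℕ → ℕ) → Rel (Tm k) 0ℓ
Lowers f g t u = ∀ {Θ L} → Θ ⊩ t ∶ L → ∃₂ λ Θ′ (M : Multi) →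
  1 ≤ length M × Θ ≃ Θ′ ⊕ ticks (f (length M)) (g (length M)) × Θ′ ⊩ u ∶ L

-- The instance of `Replacement` in which the resources freed at the typings of the redex are
-- exchanged for nothing.
Lowers-weak : ∀ {f g} → Additive f → Additive g → {R : ∀ {l} → Rel (Tm l) 0ℓ} →
              (∀ {l} {t u : Tm l} → R t u → Lowers f g t u) →
              {t u : Tm k} → Weak R t u → Lowers f g t u
Lowers-weak {f = f} {g} f-add g-add lowers (weak W r) d =
  let exchange {M} 1≤ {A} p c = Replaces-W W idʷ root d
  in  A , M , 1≤ , p , ⊩-resp (⊕-identityʳ A) (c ≃-refl)
  where
  module f = Additive f-add
  module g = Additive g-add
  open Replacement (λ M → ticks (f (length M)) (g (length M))) (λ F _ → F ≃ 𝟘)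
    (mk≃ (λ _ → ≋.refl) f.zero-homo g.zero-homo)
    (λ M N → mk≃ (λ _ → ≋.refl) (trans (cong f (length-++ M)) (f.+-homo _ _))
                                (trans (cong g (length-++ M)) (g.+-homo _ _)))
    id (λ M p → 𝟘 , 𝟘 , ≃-refl , ≃-refl , p)
  ω = skipʷ W idʷ
  root : Replaces ω _ _
  root d =
    let A , M , 1≤ , p , d′ = lowers r d
    in  exchange {index = M} 1≤ (≃-trans p (⊕-congˡ (≃-sym (push-ticks ω _ _))))
          (λ q → ⊩-resp (≃-sym (≃-trans (⊕-congˡ (≃-trans (push-cong ω q) (push-ticks ω 0 0)))
                                        (⊕-identityʳ A))) d′)

↦m-lowers : {t u : Tm k} → t ↦m u → Lowers id (λ _ → 0) t u
↦m-lowers (root-m S t u) (app {A} {B} d f p) =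
  -- `[ 𝕟 ]` serves as a list of length one: the root redex is typed once, and contraction frees the
  -- tick of its `app`.
  A ⊕ B , [ 𝕟 ] , ≤-refl , ≃-trans p (≃-sym (⊕-assoc A B (ticks 1 0))) ,
  ⊩-fill-S S idʷ {A = B} d λ { (lam d′) → es d′ (⊩⁺-rename (skipˢʷ S idʷ) f) ≃-refl }

-- The axioms for the replaced occurrence use the types `N`, so the argument is typed with `𝕟`,
-- `hd C` and `N`. The part for `N` moves into the hole and the rest stays in the substitution. Only
-- the `length N` units of `e` paid by the axioms are freed.
↦e-lowers : {t u : Tm k} → t ↦e u → Lowers (λ _ → 0) id t u
↦e-lowers (root-e W u) (es {A} {B} d f p) =
  let exchange {N} 1≤ {C} q c = Replaces-W W idʷ root d
      B₁ , B₂ , g , h , r     = ⊩⁺-split (𝕟 ∷ hd C) (⊩⁺-conv (Perm.prep 𝕟 (hd-cong q)) f)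
      T                       = ticks 0 (length N)
  in  (tl C ⊕ B₂) ⊕ B₁ , N , 1≤ ,
      (begin
        _                      ≈⟨ p ⟩
        A ⊕ B                  ≈⟨ ⊕-cong (tl-cong q) r ⟩
        tl C ⊕ T ⊕ (B₁ ⊕ B₂)   ≈⟨ ⊕-congˡ {x = tl C ⊕ T} (⊕-comm B₁ B₂) ⟩
        tl C ⊕ T ⊕ (B₂ ⊕ B₁)   ≈⟨ interchange (tl C) T B₂ B₁ ⟩
        tl C ⊕ B₂ ⊕ (T ⊕ B₁)   ≈⟨ ⊕-congˡ {x = tl C ⊕ B₂} (⊕-comm T B₁) ⟩
        tl C ⊕ B₂ ⊕ (B₁ ⊕ T)   ≈⟨ ⊕-assoc (tl C ⊕ B₂) B₁ T ⟨
        tl C ⊕ B₂ ⊕ B₁ ⊕ T     ∎) ,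
      es (⊩-resp (▹-≃ (≋.identityʳ (hd C)) ≃-refl) (c (⊩⁺-rename (sucʷ idʷ) h))) g ≃-refl
  where
  open ≃-Reasoning
  open Replacement (λ N → N ▹ ticks 0 (length N)) (λ F N → F ⊩ rename suc u ∶⁺ N)
    (▹-≃ ≋.refl ≃-refl) (λ M N → ▹-≃ ≋.refl (mk≃ (λ _ → ≋.refl) refl (length-++ M)))
    ⊩⁺-[] (λ M → ⊩⁺-split M)
  ω = skipʷ W idʷ
  root : Replaces ω (var (skip W zero)) (rename (skip W) (rename suc u))
  -- An axiom at `L` uses `[ L ]` at index zero and one unit of `e`; a typing of the argument at
  -- `[ L ]` takes its place.
  root (ax {L = L} q) =
    exchange {index = [ L ]} ≤-refl {rest = 𝟘}
      (≃-trans q (≃-trans (≃-sym (push-use ω zero L))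
        (≃-trans (push-cong ω (▹-≃ ≋.refl ≃-refl)) (≃-sym (⊕-identityˡ _)))))
      (λ h → ⊩-resp (≃-sym (⊕-identityˡ _)) (⊩-rename ω (single h)))

↦gcv-lowers : {t u : Tm k} → t ↦gcv u → Lowers (λ _ → 0) (λ _ → 0) t u
↦gcv-lowers (root-gcv t S r) (es {A} {B} d f p) =
  -- The body is renamed along `suc`, so `q` makes the multi type of the bound variable empty, and
  -- the argument is typed just once, with `𝕟`.
  let C , d′ , q = ⊩-unrename (sucʷ idʷ) t d
      ω          = skipˢʷ S idʷ
  in  B ⊕ A , [ 𝕟 ] , ≤-refl ,
      ≃-trans p (≃-trans (⊕-comm A B) (≃-sym (⊕-identityʳ (B ⊕ A)))) ,
      ⊩-fill-S S idʷ {A = A} (single (⊩⁺-conv (Perm.prep 𝕟 (hd-cong q)) f)) λ where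
        -- At type `𝕟` the erased value has no resources, so erasing it frees nothing.
        (axλ r) → ⊩-resp (≃-trans (≃-sym (⊕-identityˡ _)) (⊕-congʳ (≃-sym r)))
                         (⊩-rename ω (⊩-resp (≃-sym (tl-cong q)) d′))

id-additive : Additive id
id-additive = record { zero-homo = refl ; +-homo = λ _ _ → refl }

0-additive : Additive (λ _ → 0)
0-additive = record { zero-homo = refl ; +-homo = λ _ _ → refl }

-- A measure for garbage collection.

-- The number of explicit substitutions outside abstractions; it strictly
-- decreases along garbage collection, which leaves both indices unchanged.
#es : Tm k → ℕ
#es (var x)   = 0
#es (ƛ t)     = 0
#es (t · u)   = #es t + #es u
#es (t ⟦ u ⟧) = suc (#es t + #es u)

#es-rename : ∀ (ρ : Fin k → Fin l) t → #es (rename ρ t) ≡ #es t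
#es-rename ρ (var x)   = refl
#es-rename ρ (ƛ t)     = refl
#es-rename ρ (t · u)   = cong₂ _+_ (#es-rename ρ t) (#es-rename ρ u)
#es-rename ρ (t ⟦ u ⟧) = cong suc (cong₂ _+_ (#es-rename (ext ρ) t) (#es-rename ρ u))

-- Since `#es (ƛ r)` is zero, `#es (S ˢ⟨ ƛ r ⟩)` is the contribution of `S` alone.
#es-S : ∀ (S : SCtx k l) r t → #es (S ˢ⟨ t ⟩) ≡ #es t + #es (S ˢ⟨ ƛ r ⟩)
#es-S ∙         r t = sym (+-identityʳ (#es t))
#es-S (S ⟦ u ⟧) r t = trans
  (cong (λ n → suc (n + #es u)) (#es-S S r t))
  (trans (cong suc (+-assoc (#es t) _ (#es u))) (sym (+-suc (#es t) _)))

#es-W : ∀ (W : WCtx k l) {t u} → #es u < #es t → #es (W ⟨ u ⟩) < #es (W ⟨ t ⟩)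
#es-W ∙          p = p
#es-W (W ·ˡ t)   p = +-monoˡ-< (#es t) (#es-W W p)
#es-W (t ·ʳ W)   p = +-monoʳ-< (#es t) (#es-W W p)
#es-W (t ⟦ W ⟧ʳ) p = s≤s (+-monoʳ-< (#es t) (#es-W W p))
#es-W (W ⟦ u ⟧ˡ) p = s≤s (+-monoˡ-< (#es u) (#es-W W p))

-- The substitutions of `S` move outward and survive; exactly the collected one is lost.
→wgcv⇒#es-decreases : {t u : Tm k} → t →wgcv u → #es u < #es t
→wgcv⇒#es-decreases (weak W (root-gcv t S r)) = #es-W W (s≤s (≤-reflexive
  (trans (#es-S S r _) (cong (_+ #es (S ˢ⟨ ƛ r ⟩))
    (trans (#es-rename (skipˢ S) t) (sym (#es-rename suc t)))))))

-- Termination and bounds.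

→wm-⊩ : ∀ {t u : Tm k} {Θ L} → t →wm u → Θ ⊩ t ∶ L →
        ∃ λ Θ′ → Θ′ ⊩ u ∶ L × mul Θ′ < mul Θ × exp Θ′ ≡ exp Θ
→wm-⊩ s d =
  let Θ′ , M , 1≤ , p , d′ = Lowers-weak id-additive 0-additive ↦m-lowers s d
  in  Θ′ , d′ , <-≤-trans (m<m+n (mul Θ′) 1≤) (≤-reflexive (sym (mul-≡ p))) ,
      trans (sym (+-identityʳ _)) (sym (exp-≡ p))

→we-⊩ : ∀ {t u : Tm k} {Θ L} → t →we u → Θ ⊩ t ∶ L →
        ∃ λ Θ′ → Θ′ ⊩ u ∶ L × mul Θ′ ≡ mul Θ × exp Θ′ < exp Θ
→we-⊩ s d =
  let Θ′ , M , 1≤ , p , d′ = Lowers-weak 0-additive id-additive ↦e-lowers s d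
  in  Θ′ , d′ , trans (sym (+-identityʳ _)) (sym (mul-≡ p)) ,
      <-≤-trans (m<m+n (exp Θ′) 1≤) (≤-reflexive (sym (exp-≡ p)))

→wgcv-⊩ : ∀ {t u : Tm k} {Θ L} → t →wgcv u → Θ ⊩ t ∶ L →
          ∃ λ Θ′ → Θ′ ⊩ u ∶ L × mul Θ′ ≡ mul Θ × exp Θ′ ≡ exp Θ
→wgcv-⊩ s d =
  let Θ′ , M , 1≤ , p , d′ = Lowers-weak 0-additive 0-additive ↦gcv-lowers s d
  in  Θ′ , d′ , trans (sym (+-identityʳ _)) (sym (mul-≡ p)) ,
      trans (sym (+-identityʳ _)) (sym (exp-≡ p))

⊩⇒SN : ∀ {t : Tm k} {Θ L} → Θ ⊩ t ∶ L → SN t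
⊩⇒SN d = go _ _ d ≤-refl ≤-refl
  where
  -- `b` and `s` strictly bound the two components of the measure; the recursion is lexicographic in
  -- them.
  go : ∀ b s {t : Tm k} {Θ L} → Θ ⊩ t ∶ L → mul Θ + exp Θ < b → #es t < s → SN t
  go-→w : ∀ b s {t u : Tm k} {Θ L} → Θ ⊩ t ∶ L → mul Θ + exp Θ < b → #es t < s → t →w u → SN u
  go b s d p q = acc (go-→w b s d p q)
  go-→w (suc b) s d p q (inj₁ r) =
    let _ , d′ , m , e = →wm-⊩ r d
    -- A multiplicative step creates a substitution and an exponential one may copy several, so the
    -- second bound restarts just above the count of the reduct.
    in  go b _ d′ (<-≤-trans (+-mono-<-≤ m (≤-reflexive e)) (≤-pred p)) ≤-refl
  go-→w (suc b) s d p q (inj₂ (inj₁ r)) =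
    let _ , d′ , m , e = →we-⊩ r d
    in  go b _ d′ (<-≤-trans (+-mono-≤-< (≤-reflexive m) e) (≤-pred p)) ≤-refl
  go-→w b (suc s) d p q (inj₂ (inj₂ r)) =
    let _ , d′ , m , e = →wgcv-⊩ r d
    in  go b s d′ (≤-<-trans (≤-reflexive (cong₂ _+_ m e)) p)
          (<-≤-trans (→wgcv⇒#es-decreases r) (≤-pred q))

⊩⇒bounds : ∀ {t n : Tm k} {Θ L} → Θ ⊩ t ∶ L → (d : t →w* n) → #m d ≤ mul Θ × #e d ≤ exp Θ
⊩⇒bounds δ ε = z≤n , z≤n
⊩⇒bounds δ (inj₁ r ◅ d) =
  let _ , δ′ , m , e = →wm-⊩ r δ
      p , q          = ⊩⇒bounds δ′ d
  -- The strict drop pays for the counted step, as `a < b` is `suc a ≤ b`.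
  in  ≤-<-trans p m , ≤-trans q (≤-reflexive e)
⊩⇒bounds δ (inj₂ (inj₁ r) ◅ d) =
  let _ , δ′ , m , e = →we-⊩ r δ
      p , q          = ⊩⇒bounds δ′ d
  in  ≤-trans p (≤-reflexive m) , ≤-<-trans q e
⊩⇒bounds δ (inj₂ (inj₂ r) ◅ d) =
  let _ , δ′ , m , e = →wgcv-⊩ r δ
      p , q          = ⊩⇒bounds δ′ d
  in  ≤-trans p (≤-reflexive m) , ≤-trans q (≤-reflexive e)

theorem6p2 : ∀ {k : ℕ} (t : Tm k) {Γ : Ctx k} {m e : ℕ} {L : Lin} →
    Γ ⊢⟨ m , e ⟩ t ∶ L →
    SN t × (∀ {n : Tm k} (d : t →w* n) → Normal n → #m d ≤ m × #e d ≤ e)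
theorem6p2 t d = ⊩⇒SN (⊢⇒⊩ d) , λ r _ → ⊩⇒bounds (⊢⇒⊩ d) r
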